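{- Let $m\geq 2$, $k\geq 3$ and $n$ be integers with $k\le n$ and $n>3(m-1)$, and let $B_{n,k}$ be any $k$-regular bipartite graph with bipartition $(X,Y)$ such that $|X|=|Y|=n$. Then $$rb(B_{n,k},mK_2)=k(m-2)+2.$$
   Context: All graphs are simple and finite. $mK_2$ denotes a matching of size $m$ (that is, $m$ pairwise disjoint edges). An edge-coloring of a graph $G$ with $r$ colors is an arbitrary (not necessarily proper) assignment of colors to the edges of $G$ in which exactly $r$ distinct colors appear. A subgraph of an edge-colored graph is rainbow if no two of its edges have the same color. For a graph $G$ and a subgraph $H$ of $G$, the rainbow number $rb(G,H)$ is the minimum positive integer $r$ such that every edge-coloring of $G$ with $r$ colors contains a rainbow subgraph isomorphic to $H$. -}

module Defs where

open import Data.Fin.Base using (Fin; _<_; quotient)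
open import Data.Fin.Properties using (_≟_)
open import Data.Fin.Subset using (Subset; _∈_; _∩_; _∪_; ⊤; Empty; ∣_∣)
open import Data.Nat.Base as ℕ using (ℕ)
open import Data.Product.Base using (∃-syntax; _×_; _,_)
open import Data.Sum.Base using (_⊎_)
open import Data.Vec.Base using (tabulate)
open import Function.Base using (_∘_)
open import Function.Bundles using (_⇔_)
open import Function.Definitions using (Injective; Surjective)
open import Level using (0ℓ)
open import Relation.Binary.Core using (Rel)
open import Relation.Binary.Definitions using (Decidable; Irreflexive; Symmetric)
open import Relation.Binary.PropositionalEquality using (_≡_; _≢_; sym; ≢-sym)
open import Relation.Nullary.Decidable using (does; _×-dec_; ¬?)
open import Relation.Unary as U using (Pred)

record Graph : Set₁ where
  field
    order  : ℕ
    Adj    : Rel (Fin order) 0ℓ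
    adj?   : Decidable Adj
    symm   : Symmetric Adj
    irrefl : Irreflexive _≡_ Adj

  Vertex : Set
  Vertex = Fin order

open Graph public

module _ (G : Graph) where

  -- An unordered pair of adjacent vertices, represented with its smaller
  -- endpoint first.  The proof fields are irrelevant, so two edges are
  -- propositionally equal exactly when they have the same endpoints.
  record Edge : Set where
    constructor edge
    field
      end₁ end₂ : Vertex G
      .ordered  : end₁ < end₂
      .adjacent : Adj G end₁ end₂

  open Edge public

  Joins : Edge → Vertex G → Vertex G → Set
  Joins e u v = (end₁ e ≡ u × end₂ e ≡ v) ⊎ (end₁ e ≡ v × end₂ e ≡ u)

  degree : Vertex G → ℕ
  degree v = ∣ tabulate (does ∘ adj? G v) ∣

  IsRegular : ℕ → Set
  IsRegular k = ∀ v → degree v ≡ k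

  record IsBipartition (X Y : Subset (order G)) : Set where
    field
      covers   : X ∪ Y ≡ ⊤
      disjoint : Empty (X ∩ Y)
      crossing : ∀ {u v} → Adj G u v → (u ∈ X × v ∈ Y) ⊎ (u ∈ Y × v ∈ X)

  record Subgraph : Set₁ where
    field
      vertices : Subset (order G)
      edges    : Pred Edge 0ℓ
      edges?   : U.Decidable edges
      closed   : ∀ {e} → edges e → end₁ e ∈ vertices × end₂ e ∈ vertices

  open Subgraph public

  -- The vertices of a subgraph do not form a type Fin n, so the bijection from
  -- the vertices of H onto them is given as an injection into the vertices of
  -- G whose image is vertices S.
  record IsomorphicTo (H : Graph) (S : Subgraph) : Set where
    field
      to        : Vertex H → Vertex G
      injective : Injective _≡_ _≡_ to
      into      : ∀ u → to u ∈ vertices S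
      onto      : ∀ {w} → w ∈ vertices S → ∃[ u ] to u ≡ w
      adjacency : ∀ u v → Adj H u v ⇔ (∃[ e ] edges S e × Joins e (to u) (to v))

  -- Surjectivity says that exactly r distinct colors appear.
  record EdgeColoring (r : ℕ) : Set where
    field
      color : Edge → Fin r
      exact : Surjective _≡_ _≡_ color

  open EdgeColoring public

  Rainbow : ∀ {r} → EdgeColoring r → Subgraph → Set
  Rainbow c S = ∀ {e f} → edges S e → edges S f → color c e ≡ color c f → e ≡ f

  ForcesRainbow : Graph → ℕ → Set₁
  ForcesRainbow H r =
    (c : EdgeColoring r) → ∃[ S ] IsomorphicTo H S × Rainbow c S

  -- rb(G,H) = r, as a relation between G, H and r.
  record IsRainbowNumber (H : Graph) (r : ℕ) : Set₁ where
    field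
      positive : 1 ℕ.≤ r
      forces   : ForcesRainbow H r
      minimal  : ∀ s → 1 ℕ.≤ s → ForcesRainbow H s → r ℕ.≤ s

-- The graph mK₂: the vertices 2i and 2i+1, for i < m, are joined in pairs.
matching : ℕ → Graph
matching m = record
  { order  = m ℕ.* 2
  ; Adj    = λ u v → quotient {m} 2 u ≡ quotient {m} 2 v × u ≢ v
  ; adj?   = λ u v → (quotient {m} 2 u ≟ quotient {m} 2 v) ×-dec ¬? (u ≟ v)
  ; symm   = λ (p , q) → sym p , ≢-sym q
  ; irrefl = λ u≡v (_ , u≢v) → u≢v u≡v
  }

{-# OPTIONS --safe #-}

-- Upper bound, with t = m − 1.  Choose one edge of each color; these
-- k(t − 1) + 2 edges cannot be covered by t − 1 vertices of degree k, and not
-- even after deletion of one edge, so augmenting paths give a rainbow matching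
-- M of size t.  For each edge g of M, remove g from M and augment again among
-- the chosen edges other than g: two vertices are added, and if neither is an
-- end of g, then restoring g gives size m.  Otherwise there is a rainbow
-- matching of size t without the color of g, having at most one end z(g)
-- outside V(M).  The 2t vertices of V(M) and the t vertices z(g) are 3t < n
-- vertices, too few to cover the nk edges of the graph.  An edge e avoiding them
-- extends M if its color is not in M, and the matching for g if e and g have
-- the same color.
--
-- Lower bound: color distinctly at most k(m − 2) edges at m − 2 vertices of X
-- and use one more color for all other edges.

module Submission where

open import Data.Fin.Subset using (Subset; ∣_∣)
open import Data.Nat.Base using (ℕ; _+_; _*_; _∸_; _≤_; _<_; _≥_; _>_)
open import Relation.Binary.PropositionalEquality using (_≡_)
open import Defs
import Algebra.Properties.CommutativeSemigroup as CommutativeSemigroup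
open import Data.Fin.Base using (Fin; zero; suc; combine; remQuot; punchIn; punchOut)
import Data.Fin.Properties as Fin
open import Data.Fin.Subset using (inside; outside)
import Data.Fin.Subset as Subset
import Data.Fin.Subset.Properties as Subset
open import Data.List.Base
  using (List; []; _∷_; _++_; length; map; concatMap; lookup; tabulate; take; allFin)
import Data.List.Membership.DecPropositional as DecMembership
open import Data.List.Membership.Propositional using (_∈_; _∉_; find; lose)
open import Data.List.Membership.Propositional.Properties
  using (∈-∃++; ∈-map⁺; ∈-map⁻; ∈-++⁺ˡ; ∈-++⁺ʳ; ∈-++⁻; ∈-lookup;
         ∈-concatMap⁺; ∈-concatMap⁻; ∈-tabulate⁺; ∈-tabulate⁻)
open import Data.List.Properties
  using (length-map; length-++; length-take; length-tabulate; map-++; map-id; take++drop≡id)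
open import Data.List.Relation.Binary.Disjoint.Propositional using (Disjoint)
open import Data.List.Relation.Binary.Permutation.Propositional
  using (_↭_; ↭-refl; ↭-sym; ↭-trans; ↭⇒↭ₛ)
open import Data.List.Relation.Binary.Permutation.Propositional.Properties
  using (∈-resp-↭; ↭-length; shift) renaming (map⁺ to ↭-map⁺; ++⁺ˡ to ↭-++⁺ˡ)
import Data.List.Relation.Binary.Permutation.Setoid.Properties as SetoidPermutation
open import Data.List.Relation.Binary.Subset.Propositional using (_⊆_)
open import Data.List.Relation.Binary.Subset.Propositional.Properties using (∷⁺ʳ; ++⁺ˡ)
open import Data.List.Relation.Unary.All as All using (_∷_)
open import Data.List.Relation.Unary.All.Properties using (¬Any⇒All¬; ¬All⇒Any¬; ++⁻ˡ; ++⁻ʳ)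
open import Data.List.Relation.Unary.AllPairs using ([]; _∷_)
open import Data.List.Relation.Unary.Any using (here; there; any?; index)
open import Data.List.Relation.Unary.Any.Properties using (lookup-index)
open import Data.List.Relation.Unary.Unique.Propositional using (Unique)
import Data.List.Relation.Unary.Unique.Propositional.Properties as Unique
open import Data.Nat.Base as ℕ using (zero; suc; >-nonZero; z≤n; s≤s; s≤s⁻¹)
import Data.Nat.Properties as ℕ
open import Data.Product.Base using (∃-syntax; ∃₂; _×_; _,_; proj₁; proj₂)
open import Data.Product.Properties using (≡-dec)
open import Data.Sum.Base as Sum using (_⊎_; inj₁; inj₂)
import Data.Vec.Base as Vec
import Data.Vec.Properties as Vec
open import Function.Base using (_∘_; id)
open import Function.Bundles using (Equivalence; mk⇔)
open import Relation.Binary.Definitions using (DecidableEquality; tri<; tri≈; tri>)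
open import Relation.Binary.PropositionalEquality
  using (_≢_; refl; sym; trans; cong; cong₂; subst; setoid; module ≡-Reasoning)
open import Relation.Nullary using (¬_; Dec; yes; no; does; contradiction; ¬?; _×-dec_; recompute)
open import Relation.Nullary.Decidable using (dec-true; map′)
open import Relation.Unary using (Decidable)
open CommutativeSemigroup ℕ.+-commutativeSemigroup using (interchange)

-- Duplicate-free lists: counting, pigeonhole and permutations.

private
  variable
    A B : Set

∈⇒↭∷ : {x : A} {xs : List A} → x ∈ xs → ∃[ ys ] xs ↭ x ∷ ys
∈⇒↭∷ x∈xs with ys , zs , refl ← ∈-∃++ x∈xs = ys ++ zs , shift _ ys zs

∉⇒Unique-∷ : {x : A} {xs : List A} → x ∉ xs → Unique xs → Unique (x ∷ xs)
∉⇒Unique-∷ x∉xs u = ¬Any⇒All¬ _ x∉xs ∷ u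

Unique-tail : {x : A} {xs : List A} → Unique (x ∷ xs) → Unique xs
Unique-tail (_ ∷ u) = u

Unique-resp-↭ : {xs ys : List A} → xs ↭ ys → Unique xs → Unique ys
Unique-resp-↭ p = SetoidPermutation.Unique-resp-↭ (setoid _) (↭⇒↭ₛ p)

∈-∷⁻ : {x y : A} {xs : List A} → y ∈ x ∷ xs → y ≢ x → y ∈ xs
∈-∷⁻ (here y≡x)  y≢x = contradiction y≡x y≢x
∈-∷⁻ (there y∈) _   = y∈

-- Induction on `xs`: its head is moved to the front of `ys` and dropped there; uniqueness keeps the
-- rest of `xs` inside what remains.
Unique-⊆-length : {xs ys : List A} → Unique xs → xs ⊆ ys → length xs ≤ length ys
Unique-⊆-length {xs = []}     _ _ = z≤n
Unique-⊆-length {xs = x ∷ xs} {ys} u@(_ ∷ u′) sub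
  with zs , ys↭ ← ∈⇒↭∷ (sub (here refl)) =
  subst (suc (length xs) ≤_) (sym (↭-length ys↭))
    (s≤s (Unique-⊆-length u′ λ {z} z∈ → ∈-∷⁻ (∈-resp-↭ ys↭ (sub (there z∈)))
      λ { refl → Unique.Unique[x∷xs]⇒x∉xs u z∈ }))

pigeonhole-∉ : DecidableEquality A → {xs : List A} (ys : List A) → Unique xs →
               length ys < length xs → ∃[ x ] x ∈ xs × x ∉ ys
pigeonhole-∉ _≟_ {xs} ys u ys<xs = find (¬All⇒Any¬ (_∈? ys) xs λ all →
    ℕ.<⇒≱ ys<xs (Unique-⊆-length u (All.lookup all)))
  where open DecMembership _≟_ using (_∈?_)

Unique-++⁻ : (xs : List A) {ys : List A} → Unique (xs ++ ys) →
             Unique xs × Unique ys × Disjoint xs ys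
Unique-++⁻ []       u       = [] , u , λ ()
Unique-++⁻ (x ∷ xs) (p ∷ u) with uxs , uys , dis ← Unique-++⁻ xs u =
    ++⁻ˡ xs p ∷ uxs , uys , λ where
      (here refl , x∈ys) → All.lookup (++⁻ʳ xs p) x∈ys refl
      (there x∈ , x∈ys)  → dis (x∈ , x∈ys)

lookup-map-injective : (f : A → B) (xs : List A) → Unique (map f xs) → ∀ i j →
                       f (lookup xs i) ≡ f (lookup xs j) → i ≡ j
lookup-map-injective f (x ∷ xs) u       zero    zero    _  = refl
lookup-map-injective f (x ∷ xs) (p ∷ u) zero    (suc j) eq =
  contradiction eq (All.lookup p (∈-map⁺ f (∈-lookup {xs = xs} j)))
lookup-map-injective f (x ∷ xs) (p ∷ u) (suc i) zero    eq =
  contradiction (sym eq) (All.lookup p (∈-map⁺ f (∈-lookup {xs = xs} i)))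
lookup-map-injective f (x ∷ xs) (p ∷ u) (suc i) (suc j) eq =
  cong suc (lookup-map-injective f xs u i j eq)

length-concatMap : (f : A → List B) {k : ℕ} → (∀ x → length (f x) ≡ k) →
                   ∀ xs → length (concatMap f xs) ≡ length xs * k
length-concatMap f eq []       = refl
length-concatMap f eq (x ∷ xs) =
  trans (length-++ (f x)) (cong₂ _+_ (eq x) (length-concatMap f eq xs))

-- Augmenting paths and vertex covers in bipartite graphs.

module Augmentation
  {E A B : Set} (src : E → A) (tgt : E → B)
  (_≟ᴬ_ : DecidableEquality A) (_≟ᴮ_ : DecidableEquality B)
  where

  open DecMembership _≟ᴬ_ using () renaming (_∈?_ to _∈ᴬ?_)
  open DecMembership _≟ᴮ_ using () renaming (_∈?_ to _∈ᴮ?_)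

  Matching : List E → Set
  Matching M = Unique (map src M) × Unique (map tgt M)

  -- An augmenting path keeps all matched vertices and adds one on each side. These two are recorded
  -- because the rainbow argument has to know which vertices are new.
  record Augmented (H M : List E) : Set where
    field
      N      : List E
      newSrc : A
      newTgt : B
      N⊆H    : N ⊆ H
      match  : Matching N
      size   : length N ≡ suc (length M)
      srcs   : map src N ⊆ newSrc ∷ map src M
      tgts   : map tgt N ⊆ newTgt ∷ map tgt M

  record Cover (H : List E) (w : ℕ) : Set where
    field
      WX     : List A
      WY     : List B
      size   : length WX + length WY ≡ w
      covers : ∀ {e} → e ∈ H → src e ∈ WX ⊎ tgt e ∈ WY

  Matching-resp-↭ : ∀ {M N} → M ↭ N → Matching M → Matching N
  Matching-resp-↭ p (us , ut) = Unique-resp-↭ (↭-map⁺ src p) us , Unique-resp-↭ (↭-map⁺ tgt p) ut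

  Matching-∷ : ∀ {e M} → src e ∉ map src M → tgt e ∉ map tgt M → Matching M → Matching (e ∷ M)
  Matching-∷ s∉ t∉ (us , ut) = ∉⇒Unique-∷ s∉ us , ∉⇒Unique-∷ t∉ ut

  -- P uses the same targets as the part R of the matching M but leaves the
  -- source x free, at the price of one source outside M: it is R switched
  -- along an alternating path ending in x.
  record Freeing (H M R : List E) (x : A) : Set where
    field
      root    : A
      P       : List E
      root∉M  : root ∉ map src M
      P⊆H     : P ⊆ H
      match   : Matching P
      size    : length P ≡ length R
      srcs    : map src P ⊆ root ∷ map src R
      tgts    : map tgt P ⊆ map tgt R
      x∉P     : x ∉ map src P
      x∈      : x ∈ root ∷ map src R

  module _ {H M : List E} (M⊆H : M ⊆ H) (M-match : Matching M) where

    module _ {R U : List E} (M↭ : M ↭ R ++ U) where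

      private
        map-↭ : ∀ {C : Set} (f : E → C) → map f M ↭ map f R ++ map f U
        map-↭ f = subst (map f M ↭_) (map-++ f R U) (↭-map⁺ f M↭)

        length-M : length R + length U ≡ length M
        length-M = trans (sym (length-++ R)) (sym (↭-length M↭))

        R⊆ᶠM : ∀ {C : Set} (f : E → C) → map f R ⊆ map f M
        R⊆ᶠM f = ∈-resp-↭ (↭-sym (map-↭ f)) ∘ ∈-++⁺ˡ

        U⊆ᶠM : ∀ {C : Set} (f : E → C) → map f U ⊆ map f M
        U⊆ᶠM f = ∈-resp-↭ (↭-sym (map-↭ f)) ∘ ∈-++⁺ʳ (map f R)

        U⊆M : U ⊆ M
        U⊆M = ∈-resp-↭ (↭-sym M↭) ∘ ∈-++⁺ʳ R

        srcs-split : Unique (map src R) × Unique (map src U) × Disjoint (map src R) (map src U)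
        srcs-split = Unique-++⁻ (map src R) (Unique-resp-↭ (map-↭ src) (proj₁ M-match))

        tgts-split : Unique (map tgt R) × Unique (map tgt U) × Disjoint (map tgt R) (map tgt U)
        tgts-split = Unique-++⁻ (map tgt R) (Unique-resp-↭ (map-↭ tgt) (proj₂ M-match))

      -- The cover of König's theorem: every edge of `M` contributes exactly one end, its source if
      -- it is in `U` and its target if it is in `R`.
      cover : (∀ {e} → e ∈ H → src e ∈ map src U ⊎ tgt e ∈ map tgt R) → Cover H (length M)
      cover covers = record
        { WX     = map src U
        ; WY     = map tgt R
        ; size   = trans (cong₂ _+_ (length-map src U) (length-map tgt R))
                   (trans (ℕ.+-comm (length U) (length R)) length-M)
        ; covers = covers
        }

      -- Switching `R` to `P` frees `src e` without touching new targets, so `e` fits next to `P`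
      -- and the unchanged part `U`. The two vertices gained are the ends of the alternating path.
      augmentation : ∀ {e} → e ∈ H → src e ∉ map src U → tgt e ∉ map tgt U → tgt e ∉ map tgt R →
                     Freeing H M R (src e) → Augmented H M
      augmentation {e} e∈H s∉U t∉U t∉R free = record
        { N      = e ∷ P ++ U
        ; newSrc = root
        ; newTgt = tgt e
        ; N⊆H    = λ where
            (here refl) → e∈H
            (there p)   → Sum.[ P⊆H , M⊆H ∘ U⊆M ]′ (∈-++⁻ P p)
        ; match  = Matching-∷
            (Sum.[ x∉P , s∉U ]′ ∘ split src)
            (Sum.[ t∉R ∘ tgts , t∉U ]′ ∘ split tgt)
            ( subst Unique (sym (map-++ src P U)) (Unique.++⁺ (proj₁ match) (proj₁ (proj₂ srcs-split))
                λ (p , q) → avoid (srcs p) q)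
            , subst Unique (sym (map-++ tgt P U)) (Unique.++⁺ (proj₂ match) (proj₁ (proj₂ tgts-split))
                λ (p , q) → proj₂ (proj₂ tgts-split) (tgts p , q)))
        ; size   = cong suc (trans (length-++ P) (trans (cong (_+ length U) size) length-M))
        ; srcs   = λ where
            (here refl) → ∷⁺ʳ root (R⊆ᶠM src) x∈
            (there p)   → Sum.[ ∷⁺ʳ root (R⊆ᶠM src) ∘ srcs , there ∘ U⊆ᶠM src ]′ (split src p)
        ; tgts   = λ where
            (here refl) → here refl
            (there p)   → there (Sum.[ R⊆ᶠM tgt ∘ tgts , U⊆ᶠM tgt ]′ (split tgt p))
        }
        where
        open Freeing free
        split : ∀ {C : Set} (f : E → C) {c} → c ∈ map f (P ++ U) → c ∈ map f P ⊎ c ∈ map f U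
        split f c∈ = ∈-++⁻ (map f P) (subst (_ ∈_) (map-++ f P U) c∈)
        avoid : ∀ {a} → a ∈ root ∷ map src R → a ∉ map src U
        avoid (here refl) q = root∉M (U⊆ᶠM src q)
        avoid (there p)   q = proj₂ (proj₂ srcs-split) (p , q)

    module _ {R U : List E} {f : E} (M↭ : M ↭ R ++ f ∷ U) where

      private
        M↭′ : M ↭ f ∷ R ++ U
        M↭′ = ↭-trans M↭ (shift f R U)

        f∈M : f ∈ M
        f∈M = ∈-resp-↭ (↭-sym M↭′) (here refl)

        sf∉R : src f ∉ map src R
        sf∉R p = Unique.Unique[x∷xs]⇒x∉xs (proj₁ (Matching-resp-↭ M↭′ M-match))
          (subst (_ ∈_) (sym (map-++ src R U)) (∈-++⁺ˡ p))

        tf∉R : tgt f ∉ map tgt R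
        tf∉R p = Unique.Unique[x∷xs]⇒x∉xs (proj₂ (Matching-resp-↭ M↭′ M-match))
          (subst (_ ∈_) (sym (map-++ tgt R U)) (∈-++⁺ˡ p))

        sf∉P : ∀ {x} (F : Freeing H M R x) → src f ∉ map src (Freeing.P F)
        sf∉P F p with Freeing.srcs F p
        ... | here eq = Freeing.root∉M F (subst (_∈ map src M) eq (∈-map⁺ src f∈M))
        ... | there q = sf∉R q

      -- The alternating path to `x` does not pass through `f`, so `f` stays in the matching as it
      -- is.
      freeing-keep : ∀ {x} → x ≢ src f → Freeing H M R x → Freeing H M (f ∷ R) x
      freeing-keep x≢ F = record
        { root   = root
        ; P      = f ∷ P
        ; root∉M = root∉M
        ; P⊆H    = λ { (here refl) → M⊆H f∈M ; (there p) → P⊆H p }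
        ; match  = Matching-∷ (sf∉P F) (tf∉R ∘ tgts) match
        ; size   = cong suc size
        ; srcs   = λ { (here refl) → there (here refl) ; (there p) → insert (srcs p) }
        ; tgts   = ∷⁺ʳ _ tgts
        ; x∉P    = λ { (here eq) → x≢ eq ; (there p) → x∉P p }
        ; x∈     = insert x∈
        }
        where
        open Freeing F
        insert : root ∷ map src R ⊆ root ∷ src f ∷ map src R
        insert = ∷⁺ʳ _ there

      -- The alternating path to `src e` is prolonged by `e` and `f`: `e` takes over the target of
      -- `f`, which leaves the source of `f` free.
      freeing-switch : ∀ {e} → e ∈ H → src e ≢ src f → tgt e ≡ tgt f →
                       Freeing H M R (src e) → Freeing H M (f ∷ R) (src f)
      freeing-switch {e} e∈H s≢ t≡ F = record
        { root   = root
        ; P      = e ∷ P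
        ; root∉M = root∉M
        ; P⊆H    = λ { (here refl) → e∈H ; (there p) → P⊆H p }
        ; match  = Matching-∷ x∉P (λ p → tf∉R (subst (_∈ map tgt R) t≡ (tgts p))) match
        ; size   = cong suc size
        ; srcs   = λ { (here refl) → insert x∈ ; (there p) → insert (srcs p) }
        ; tgts   = λ { (here eq) → here (trans eq t≡) ; (there p) → there (tgts p) }
        ; x∉P    = λ { (here eq) → s≢ (sym eq) ; (there p) → sf∉P F p }
        ; x∈     = there (here refl)
        }
        where
        open Freeing F
        insert : root ∷ map src R ⊆ root ∷ src f ∷ map src R
        insert = ∷⁺ʳ _ there

    private
      -- R consists of the edges of M reached so far by alternating paths from
      -- unmatched sources, U of the remaining ones.
      search : ∀ n R U → length U ≤ n → M ↭ R ++ U →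
               (∀ x → x ∉ map src U → Freeing H M R x) →
               Augmented H M ⊎ Cover H (length M)
      search n R U U≤n M↭ free
        -- An edge is sought that leaves the reached part: its source can be freed and its target is
        -- not yet reached.
        with any? (λ e → ¬? (src e ∈ᴬ? map src U) ×-dec ¬? (tgt e ∈ᴮ? map tgt R)) H
      ... | no none = inj₂ (cover M↭ covers)
        where
        covers : ∀ {e} → e ∈ H → src e ∈ map src U ⊎ tgt e ∈ map tgt R
        covers {e} e∈H with src e ∈ᴬ? map src U | tgt e ∈ᴮ? map tgt R
        ... | yes p | _     = inj₁ p
        ... | no _  | yes q = inj₂ q
        ... | no ¬p | no ¬q = contradiction (lose e∈H (¬p , ¬q)) none
      ... | yes some
        with e , e∈H , s∉U , t∉R ← find some
        with tgt e ∈ᴮ? map tgt U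
      -- The target lies in neither `R` nor `U`, hence is unmatched, and the path augments.
      ... | no t∉U = inj₁ (augmentation M↭ e∈H s∉U t∉U t∉R (free (src e) s∉U))
      -- The target is matched by an edge `f` of `U`, which now moves to the reached part.
      ... | yes t∈U
        with f , f∈U , t≡ ← ∈-map⁻ tgt t∈U
        with U′ , U↭ ← ∈⇒↭∷ f∈U
        with n
      -- `n` bounds the length of `U` and makes the recursion structural; it cannot be zero while
      -- `f` is in `U`.
      ... | zero  = contradiction (subst (_≤ 0) (↭-length U↭) U≤n) λ ()
      ... | suc n =
        search n (f ∷ R) U′ (s≤s⁻¹ (subst (_≤ suc n) (↭-length U↭) U≤n))
          (↭-trans M↭ᶠ (shift f R U′)) free′
        where
        M↭ᶠ : M ↭ R ++ f ∷ U′
        M↭ᶠ = ↭-trans M↭ (↭-++⁺ˡ R U↭)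
        free′ : ∀ x → x ∉ map src U′ → Freeing H M (f ∷ R) x
        free′ x x∉ with x ≟ᴬ src f
        ... | yes refl = freeing-switch M↭ᶠ e∈H
                (λ eq → s∉U (subst (_∈ map src U) (sym eq) (∈-map⁺ src f∈U))) t≡ (free (src e) s∉U)
        ... | no x≢    = freeing-keep M↭ᶠ x≢ (free x λ p →
                x∉ (∈-∷⁻ (∈-resp-↭ (↭-map⁺ src U↭) p) x≢))

    augment : Augmented H M ⊎ Cover H (length M)
    -- At the start only the unmatched sources are reached, each by the empty path with itself as
    -- root.
    augment = search (length M) [] M ℕ.≤-refl ↭-refl λ x x∉ → record
      { root   = x
      ; P      = []
      ; root∉M = x∉
      ; P⊆H    = λ ()
      ; match  = [] , []
      ; size   = refl
      ; srcs   = λ ()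
      ; tgts   = λ ()
      ; x∉P    = λ ()
      ; x∈     = here refl
      }

  -- A failed augmentation of a matching of size `j` would leave a cover by `j` vertices, which is
  -- excluded below `t`.
  grow : {H : List E} {t : ℕ} → (∀ w → w < t → ¬ Cover H w) → ∀ j → j ≤ t →
         ∃[ M ] M ⊆ H × Matching M × length M ≡ j
  grow no-cover zero    _ = [] , (λ ()) , ([] , []) , refl
  grow no-cover (suc j) j<t
    with M , M⊆H , match , refl ← grow no-cover j (ℕ.<⇒≤ j<t)
    with augment M⊆H match
  ... | inj₁ aug = N , N⊆H , match′ , size
    where open Augmented aug renaming (match to match′)
  ... | inj₂ cov = contradiction cov (no-cover j j<t)

-- Subsets as lists, and subsets given by decidable predicates.

elements : ∀ {n} → Subset n → List (Fin n)
elements Vec.[]              = []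
elements (inside  Vec.∷ p) = zero ∷ map suc (elements p)
elements (outside Vec.∷ p) = map suc (elements p)

length-elements : ∀ {n} (p : Subset n) → length (elements p) ≡ ∣ p ∣
length-elements Vec.[]              = refl
length-elements (inside  Vec.∷ p) =
  cong suc (trans (length-map suc (elements p)) (length-elements p))
length-elements (outside Vec.∷ p) = trans (length-map suc (elements p)) (length-elements p)

∈-elements⁺ : ∀ {n} {p : Subset n} {i} → i Subset.∈ p → i ∈ elements p
∈-elements⁺ {p = inside  Vec.∷ p} Vec.here       = here refl
∈-elements⁺ {p = inside  Vec.∷ p} (Vec.there i∈) = there (∈-map⁺ suc (∈-elements⁺ i∈))
∈-elements⁺ {p = outside Vec.∷ p} (Vec.there i∈) = ∈-map⁺ suc (∈-elements⁺ i∈)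

∈-elements⁻ : ∀ {n} {p : Subset n} {i} → i ∈ elements p → i Subset.∈ p
∈-elements⁻ {p = inside  Vec.∷ p} (here refl) = Vec.here
∈-elements⁻ {p = inside  Vec.∷ p} (there i∈)
  with j , j∈ , refl ← ∈-map⁻ suc i∈ = Vec.there (∈-elements⁻ j∈)
∈-elements⁻ {p = outside Vec.∷ p} i∈
  with j , j∈ , refl ← ∈-map⁻ suc i∈ = Vec.there (∈-elements⁻ j∈)

Unique-elements : ∀ {n} (p : Subset n) → Unique (elements p)
Unique-elements Vec.[]            = []
Unique-elements (inside  Vec.∷ p) =
  ∉⇒Unique-∷ (λ 0∈ → Fin.0≢1+n (proj₂ (proj₂ (∈-map⁻ suc 0∈))))
    (Unique.map⁺ Fin.suc-injective (Unique-elements p))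
Unique-elements (outside Vec.∷ p) = Unique.map⁺ Fin.suc-injective (Unique-elements p)

module _ {n} {P : Fin n → Set} (P? : Decidable P) where

  -- The same tabulation as in `degree`, so that regularity gives the size of a neighbourhood
  -- directly.
  satisfying : Subset n
  satisfying = Vec.tabulate (does ∘ P?)

  ∈-satisfying⁺ : ∀ {i} → P i → i Subset.∈ satisfying
  ∈-satisfying⁺ {i} p = Vec.lookup⇒[]= i satisfying
    (trans (Vec.lookup∘tabulate (does ∘ P?) i) (dec-true (P? i) p))

  ∈-satisfying⁻ : ∀ {i} → i Subset.∈ satisfying → P i
  ∈-satisfying⁻ {i} i∈ = from-does (P? i)
    (trans (sym (Vec.lookup∘tabulate (does ∘ P?) i)) (Vec.[]=⇒lookup i∈))
    where
    from-does : ∀ {Q : Set} (q? : Dec Q) → does q? ≡ inside → Q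
    from-does (yes q) _ = q

-- Edges oriented from `X` to `Y`, and counting edges by stars.

module BipartiteGraph
  (G : Graph) (X Y : Subset (order G)) (bip : IsBipartition G X Y)
  where

  open IsBipartition bip

  X∩Y=∅ : ∀ {v} → v Subset.∈ X → ¬ (v Subset.∈ Y)
  X∩Y=∅ {v} v∈X v∈Y = disjoint (v , Subset.x∈p∩q⁺ (v∈X , v∈Y))

  private
    -- Adjacency is an irrelevant field of an edge; decidability of `Adj` recovers a usable proof,
    -- and `crossing` then tells which end lies in `X`.
    orient : (e : Edge G) → ∃₂ λ x y → Joins G e x y × x Subset.∈ X × y Subset.∈ Y × Adj G x y
    orient (edge u v u<v uv) with crossing (recompute (adj? G u v) uv)
    ... | inj₁ (u∈X , v∈Y) = u , v , inj₁ (refl , refl) , u∈X , v∈Y , recompute (adj? G u v) uv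
    ... | inj₂ (u∈Y , v∈X) =
      v , u , inj₂ (refl , refl) , v∈X , u∈Y , symm G (recompute (adj? G u v) uv)

  src tgt : Edge G → Vertex G
  src e = proj₁ (orient e)
  tgt e = proj₁ (proj₂ (orient e))

  joins : ∀ e → Joins G e (src e) (tgt e)
  joins e = proj₁ (proj₂ (proj₂ (orient e)))

  src∈X : ∀ e → src e Subset.∈ X
  src∈X e = proj₁ (proj₂ (proj₂ (proj₂ (orient e))))

  tgt∈Y : ∀ e → tgt e Subset.∈ Y
  tgt∈Y e = proj₁ (proj₂ (proj₂ (proj₂ (proj₂ (orient e)))))

  src-adj-tgt : ∀ e → Adj G (src e) (tgt e)
  src-adj-tgt e = proj₂ (proj₂ (proj₂ (proj₂ (proj₂ (orient e)))))

  src≢tgt : ∀ e f → src e ≢ tgt f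
  src≢tgt e f eq = X∩Y=∅ (src∈X e) (subst (Subset._∈ Y) (sym eq) (tgt∈Y f))

  Joins-injective : ∀ e f {u v} → Joins G e u v → Joins G f u v → e ≡ f
  Joins-injective (edge _ _ _ _)   (edge _ _ _ _) (inj₁ (refl , refl)) (inj₁ (refl , refl)) = refl
  Joins-injective (edge _ _ _ _)   (edge _ _ _ _) (inj₂ (refl , refl)) (inj₂ (refl , refl)) = refl
  Joins-injective (edge u v u<v _) (edge _ _ v<u _) (inj₁ (refl , refl)) (inj₂ (refl , refl)) =
    contradiction (recompute (v Fin.<? u) v<u) (Fin.<-asym (recompute (u Fin.<? v) u<v))
  Joins-injective (edge u v u<v _) (edge _ _ v<u _) (inj₂ (refl , refl)) (inj₁ (refl , refl)) =
    contradiction (recompute (v Fin.<? u) v<u) (Fin.<-asym (recompute (u Fin.<? v) u<v))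

  Joins-sym : ∀ e {u v} → Joins G e u v → Joins G e v u
  Joins-sym e (inj₁ eqs) = inj₂ eqs
  Joins-sym e (inj₂ eqs) = inj₁ eqs

  ends : Edge G → Vertex G × Vertex G
  ends e = src e , tgt e

  ends-injective : ∀ {e f} → ends e ≡ ends f → e ≡ f
  ends-injective {e} {f} eq = Joins-injective e f (joins e)
    (subst (λ (x , y) → Joins G f x y) (sym eq) (joins f))

  Joins-ends : ∀ e {x y} → Joins G e x y → (src e ≡ x × tgt e ≡ y) ⊎ (src e ≡ y × tgt e ≡ x)
  Joins-ends e = compare (joins e)
    where
    compare : ∀ {a b x y} → Joins G e a b → Joins G e x y → (a ≡ x × b ≡ y) ⊎ (a ≡ y × b ≡ x)
    compare (inj₁ (refl , refl)) (inj₁ (refl , refl)) = inj₁ (refl , refl)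
    compare (inj₁ (refl , refl)) (inj₂ (refl , refl)) = inj₂ (refl , refl)
    compare (inj₂ (refl , refl)) (inj₁ (refl , refl)) = inj₂ (refl , refl)
    compare (inj₂ (refl , refl)) (inj₂ (refl , refl)) = inj₁ (refl , refl)

  Adj⇒Joins : ∀ {u v} → Adj G u v → ∃[ e ] Joins G e u v
  Adj⇒Joins {u} {v} uv with Fin.<-cmp u v
  ... | tri< u<v _ _  = edge u v u<v uv , inj₁ (refl , refl)
  ... | tri≈ _ refl _ = contradiction uv (irrefl G refl)
  ... | tri> _ _ v<u  = edge v u v<u (symm G uv) , inj₂ (refl , refl)

  Adj⇒ends : ∀ {x y} → x Subset.∈ X → Adj G x y → ∃[ e ] ends e ≡ (x , y)
  Adj⇒ends {x} {y} x∈X xy with e , j ← Adj⇒Joins xy with Joins-ends e j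
  ... | inj₁ (refl , refl) = e , refl
  ... | inj₂ (_ , t≡)      = contradiction (subst (Subset._∈ Y) t≡ (tgt∈Y e)) (X∩Y=∅ x∈X)

  _≟ᵛ_ : DecidableEquality (Vertex G)
  _≟ᵛ_ = Fin._≟_

  _≟ᵖ_ : DecidableEquality (Vertex G × Vertex G)
  _≟ᵖ_ = ≡-dec Fin._≟_ Fin._≟_

  neighbours : Vertex G → List (Vertex G)
  neighbours v = elements (satisfying (adj? G v))

  -- Both kinds of star put the source first, so that pairs from either side can be compared with
  -- `ends`.
  outStar inStar : Vertex G → List (Vertex G × Vertex G)
  outStar x = map (x ,_) (neighbours x)
  inStar  y = map (_, y) (neighbours y)

  ∈-outStar⁺ : ∀ {x y} → Adj G x y → (x , y) ∈ outStar x
  ∈-outStar⁺ xy = ∈-map⁺ _ (∈-elements⁺ (∈-satisfying⁺ (adj? G _) xy))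

  ∈-outStar⁻ : ∀ {x p} → p ∈ outStar x → proj₁ p ≡ x × Adj G x (proj₂ p)
  ∈-outStar⁻ p∈ with y , y∈ , refl ← ∈-map⁻ _ p∈ = refl , ∈-satisfying⁻ (adj? G _) (∈-elements⁻ y∈)

  ∈-inStar⁺ : ∀ {x y} → Adj G x y → (x , y) ∈ inStar y
  ∈-inStar⁺ xy = ∈-map⁺ _ (∈-elements⁺ (∈-satisfying⁺ (adj? G _) (symm G xy)))

  outStars : List (Vertex G) → List (Vertex G × Vertex G)
  outStars = concatMap outStar

  ∈-outStars⁻ : ∀ {xs p} → p ∈ outStars xs → proj₁ p ∈ xs × Adj G (proj₁ p) (proj₂ p)
  ∈-outStars⁻ {xs} p∈ with x , x∈ , p∈x ← find (∈-concatMap⁻ outStar {xs} p∈)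
    with refl , a ← ∈-outStar⁻ p∈x = x∈ , a

  Unique-outStars : ∀ {xs} → Unique xs → Unique (outStars xs)
  Unique-outStars {[]}     []         = []
  Unique-outStars {x ∷ xs} u@(_ ∷ u′) = Unique.++⁺
    (Unique.map⁺ (λ { refl → refl }) (Unique-elements (satisfying (adj? G x))))
    (Unique-outStars u′)
    λ (p∈ , q∈) → Unique.Unique[x∷xs]⇒x∉xs u
      (subst (_∈ xs) (proj₁ (∈-outStar⁻ p∈)) (proj₁ (∈-outStars⁻ q∈)))

  module _ {k} (reg : IsRegular G k) where

    length-neighbours : ∀ v → length (neighbours v) ≡ k
    length-neighbours v = trans (length-elements (satisfying (adj? G v))) (reg v)

    length-outStars : ∀ xs → length (outStars xs) ≡ length xs * k
    length-outStars = length-concatMap outStar λ x →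
      trans (length-map _ (neighbours x)) (length-neighbours x)

    length-inStars : ∀ ys → length (concatMap inStar ys) ≡ length ys * k
    length-inStars = length-concatMap inStar λ y →
      trans (length-map _ (neighbours y)) (length-neighbours y)

    stars : List (Vertex G) → List (Vertex G) → List (Vertex G × Vertex G)
    stars xs ys = outStars xs ++ concatMap inStar ys

    length-stars : ∀ xs ys → length (stars xs ys) ≡ (length xs + length ys) * k
    length-stars xs ys = trans (length-++ (outStars xs))
      (trans (cong₂ _+_ (length-outStars xs) (length-inStars ys))
        (sym (ℕ.*-distribʳ-+ k (length xs) (length ys))))

    ∈-stars : ∀ {xs ys x y} → Adj G x y → x ∈ xs ⊎ y ∈ ys → (x , y) ∈ stars xs ys
    ∈-stars {xs} xy (inj₁ x∈) = ∈-++⁺ˡ (∈-concatMap⁺ outStar (lose x∈ (∈-outStar⁺ xy)))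
    ∈-stars {xs} xy (inj₂ y∈) = ∈-++⁺ʳ (outStars xs) (∈-concatMap⁺ inStar (lose y∈ (∈-inStar⁺ xy)))

    -- Each covering vertex contributes a star of `k` pairs, and `ends` maps the covered edges
    -- injectively into these stars.
    covered-length : ∀ {es : List (Edge G)} {xs ys} → Unique es →
                     (∀ {e} → e ∈ es → src e ∈ xs ⊎ tgt e ∈ ys) →
                     length es ≤ (length xs + length ys) * k
    covered-length {es} {xs} {ys} u cov = begin
      length es                     ≡⟨ length-map ends es ⟨
      length (map ends es)          ≤⟨ Unique-⊆-length (Unique.map⁺ ends-injective u) ends⊆ ⟩
      length (stars xs ys)          ≡⟨ length-stars xs ys ⟩
      (length xs + length ys) * k   ∎
      where
      open ℕ.≤-Reasoning
      ends⊆ : ∀ {p} → p ∈ map ends es → p ∈ stars xs ys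
      ends⊆ p∈ with e , e∈ , refl ← ∈-map⁻ ends p∈ = ∈-stars (src-adj-tgt e) (cov e∈)

    private
      outStars-X : List (Vertex G × Vertex G)
      outStars-X = outStars (elements X)

      length-outStars-X : length outStars-X ≡ ∣ X ∣ * k
      length-outStars-X = trans (length-outStars (elements X)) (cong (_* k) (length-elements X))

      edge-among : ∀ {ps} → ∃[ p ] p ∈ outStars-X × p ∉ ps → ∃[ e ] ends e ∉ ps
      edge-among ((x , y) , p∈ , p∉)
        with x∈ , xy ← ∈-outStars⁻ p∈
        with e , refl ← Adj⇒ends (∈-elements⁻ x∈) xy = e , p∉

    -- The stars at the vertices of `X` are disjoint and consist of `∣ X ∣ * k` pairs, all of them
    -- edges; a shorter list misses one.
    edge-avoiding : (ps : List (Vertex G × Vertex G)) → length ps < ∣ X ∣ * k →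
                    ∃[ e ] ends e ∉ ps
    edge-avoiding ps small = edge-among (pigeonhole-∉ _≟ᵖ_ ps
      (Unique-outStars (Unique-elements X))
      (subst (length ps <_) (sym length-outStars-X) small))

    -- Fewer than `∣ X ∣` stars contain fewer than `∣ X ∣ * k` pairs, so they cannot exhaust the
    -- edges.
    uncovered-edge : 0 < k → ∀ xs ys → length xs + length ys < ∣ X ∣ →
                     ∃[ e ] src e ∉ xs × tgt e ∉ ys
    uncovered-edge 0<k xs ys small = uncovered (edge-avoiding (stars xs ys)
      (subst (_< ∣ X ∣ * k) (sym (length-stars xs ys))
        (ℕ.*-monoˡ-< k {{>-nonZero 0<k}} small)))
      where
      uncovered : ∃[ e ] ends e ∉ stars xs ys → ∃[ e ] src e ∉ xs × tgt e ∉ ys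
      uncovered (e , e∉) =
        e , (λ p → e∉ (∈-stars {xs} {ys} (src-adj-tgt e) (inj₁ p)))
          , (λ p → e∉ (∈-stars {xs} {ys} (src-adj-tgt e) (inj₂ p)))

-- Rainbow matchings as families of edges and as copies of `matching m`.

module RainbowMatchings
  (G : Graph) (X Y : Subset (order G)) (bip : IsBipartition G X Y)
  where

  open BipartiteGraph G X Y bip

  _≟ᵉ_ : DecidableEquality (Edge G)
  e ≟ᵉ f = map′ ends-injective (cong ends) (ends e ≟ᵖ ends f)

  -- Distinct sources and distinct targets already make the edges disjoint, since a source is never
  -- a target.
  record RainbowMatching {r} (c : EdgeColoring G r) (m : ℕ) : Set where
    field
      edgeOf          : Fin m → Edge G
      src-injective   : ∀ i j → src (edgeOf i) ≡ src (edgeOf j) → i ≡ j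
      tgt-injective   : ∀ i j → tgt (edgeOf i) ≡ tgt (edgeOf j) → i ≡ j
      color-injective : ∀ i j → color c (edgeOf i) ≡ color c (edgeOf j) → i ≡ j

  module _ {r} {c : EdgeColoring G r} {m} (M : RainbowMatching c m) where

    open RainbowMatching M

    private
      -- Vertices of `matching m` are read through `remQuot` as an edge index together with a side;
      -- adjacency there means equal index and different side.
      end : Fin m × Fin 2 → Vertex G
      end (i , zero)  = src (edgeOf i)
      end (i , suc _) = tgt (edgeOf i)

      end-injective : ∀ p q → end p ≡ end q → p ≡ q
      end-injective (i , zero)     (j , zero)     eq = cong (_, zero) (src-injective i j eq)
      end-injective (i , zero)     (j , suc _)    eq =
        contradiction eq (src≢tgt (edgeOf i) (edgeOf j))
      end-injective (i , suc _)    (j , zero)     eq =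
        contradiction (sym eq) (src≢tgt (edgeOf j) (edgeOf i))
      end-injective (i , suc zero) (j , suc zero) eq = cong (_, suc zero) (tgt-injective i j eq)

      Joins-end : ∀ p q → proj₁ p ≡ proj₁ q → p ≢ q → Joins G (edgeOf (proj₁ p)) (end p) (end q)
      Joins-end (i , zero)     (i , zero)     refl p≢q = contradiction refl p≢q
      Joins-end (i , zero)     (i , suc zero) refl p≢q = joins (edgeOf i)
      Joins-end (i , suc zero) (i , zero)     refl p≢q = Joins-sym (edgeOf i) (joins (edgeOf i))
      Joins-end (i , suc zero) (i , suc zero) refl p≢q = contradiction refl p≢q

      Joins-end⁻ : ∀ p q i → Joins G (edgeOf i) (end p) (end q) → proj₁ p ≡ proj₁ q × p ≢ q
      Joins-end⁻ p q i j with Joins-ends (edgeOf i) j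
      ... | inj₁ (s≡ , t≡)
        with refl ← end-injective (i , zero) p s≡
        with refl ← end-injective (i , suc zero) q t≡ = refl , λ ()
      ... | inj₂ (s≡ , t≡)
        with refl ← end-injective (i , zero) q s≡
        with refl ← end-injective (i , suc zero) p t≡ = refl , λ ()

      to : Fin (m * 2) → Vertex G
      to = end ∘ remQuot {m} 2

      remQuot-injective : ∀ {u v} → remQuot {m} 2 u ≡ remQuot {m} 2 v → u ≡ v
      remQuot-injective {u} {v} eq = trans (sym (Fin.combine-remQuot {m} 2 u))
        (trans (cong (λ (i , j) → combine i j) eq) (Fin.combine-remQuot {m} 2 v))

      to-injective : ∀ {u v} → to u ≡ to v → u ≡ v
      to-injective {u} {v} eq =
        remQuot-injective (end-injective (remQuot {m} 2 u) (remQuot {m} 2 v) eq)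

      to-combine : ∀ i j → to (combine i j) ≡ end (i , j)
      to-combine i j = cong end (Fin.remQuot-combine i j)

      image? : (v : Vertex G) → Dec (∃[ u ] to u ≡ v)
      image? v = Fin.any? λ u → to u Fin.≟ v

      end∈image : ∀ p → end p Subset.∈ satisfying image?
      end∈image (i , j) = ∈-satisfying⁺ image? (combine i j , to-combine i j)

    matchingSubgraph : Subgraph G
    matchingSubgraph = record
      { vertices = satisfying image?
      ; edges    = λ e → ∃[ i ] edgeOf i ≡ e
      ; edges?   = λ e → Fin.any? λ i → edgeOf i ≟ᵉ e
      ; closed   = λ { (i , refl) → closed′ (edgeOf i) (joins (edgeOf i))
                                      (end∈image (i , zero)) (end∈image (i , suc zero)) }
      }
      where
      closed′ : ∀ e {x y} → Joins G e x y → x Subset.∈ satisfying image? →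
                y Subset.∈ satisfying image? →
                end₁ e Subset.∈ satisfying image? × end₂ e Subset.∈ satisfying image?
      closed′ e (inj₁ (refl , refl)) x∈ y∈ = x∈ , y∈
      closed′ e (inj₂ (refl , refl)) x∈ y∈ = y∈ , x∈

    matchingSubgraph-iso : IsomorphicTo G (matching m) matchingSubgraph
    matchingSubgraph-iso = record
      { to        = to
      ; injective = to-injective
      ; into      = λ u → ∈-satisfying⁺ image? (u , refl)
      ; onto      = ∈-satisfying⁻ image?
      ; adjacency = λ u v → mk⇔
          (λ (eq , u≢v) → _ , (_ , refl) ,
            Joins-end (remQuot {m} 2 u) (remQuot {m} 2 v) eq (u≢v ∘ remQuot-injective))
          (λ { (_ , (i , refl) , j) →
            let eq , p≢q = Joins-end⁻ (remQuot {m} 2 u) (remQuot {m} 2 v) i j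
            in eq , λ u≡v → p≢q (cong (remQuot {m} 2) u≡v) })
      }

    matchingSubgraph-rainbow : Rainbow G c matchingSubgraph
    matchingSubgraph-rainbow (i , refl) (j , refl) eq = cong edgeOf (color-injective i j eq)

  module _ {m} {S : Subgraph G} (iso : IsomorphicTo G (matching m) S) where

    open IsomorphicTo iso

    private
      adjacent-pair : ∀ i → Adj (matching m) (combine i zero) (combine i (suc zero))
      adjacent-pair i =
        trans (cong proj₁ (Fin.remQuot-combine {m} i zero))
          (sym (cong proj₁ (Fin.remQuot-combine {m} i (suc zero)))) ,
        λ eq → contradiction (Fin.combine-injectiveʳ i zero i (suc zero) eq) λ ()

      pair-edge : ∀ i → ∃[ e ] edges S e ×
                        Joins G e (to (combine i zero)) (to (combine i (suc zero)))
      pair-edge i = Equivalence.to (adjacency _ _) (adjacent-pair i)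

      -- The isomorphism may send either vertex of a pair to the `X` side, so the side `a` is left
      -- open.
      src≡to : ∀ i → ∃[ a ] src (proj₁ (pair-edge i)) ≡ to (combine i a)
      src≡to i with Joins-ends (proj₁ (pair-edge i)) (proj₂ (proj₂ (pair-edge i)))
      ... | inj₁ (s≡ , _) = zero , s≡
      ... | inj₂ (s≡ , _) = suc zero , s≡

    matchingEdge : Fin m → Edge G
    matchingEdge i = proj₁ (pair-edge i)

    matchingEdge∈S : ∀ i → edges S (matchingEdge i)
    matchingEdge∈S i = proj₁ (proj₂ (pair-edge i))

    -- A common source would be the image of a vertex from pair `i` and of one from pair `j`;
    -- injectivity of `to` identifies them.
    src-matchingEdge-injective : ∀ {i j} → src (matchingEdge i) ≡ src (matchingEdge j) → i ≡ j
    src-matchingEdge-injective {i} {j} eq = let a , p = src≡to i ; b , q = src≡to j in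
      Fin.combine-injectiveˡ i a j b (injective (trans (sym p) (trans eq q)))

  -- A rainbow matching has at most one edge of color zero, and its other
  -- edges have distinct ends in xs.
  rainbow-matching-bound : ∀ {r} (c : EdgeColoring G (suc r)) (xs : List (Vertex G)) →
    (∀ e → color c e ≡ zero ⊎ src e ∈ xs) →
    ∀ {m S} → IsomorphicTo G (matching m) S → Rainbow G c S → m ≤ suc (length xs)
  rainbow-matching-bound c xs split {m} {S} iso rainbow = Fin.injective⇒≤ {f = slot} slot-injective
    where
    e : Fin m → Edge G
    e = matchingEdge {S = S} iso
    slot′ : ∀ {i} → color c (e i) ≡ zero ⊎ src (e i) ∈ xs → Fin (suc (length xs))
    slot′ (inj₁ _) = zero
    slot′ (inj₂ p) = suc (index p)
    slot : Fin m → Fin (suc (length xs))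
    slot i = slot′ {i} (split (e i))
    slot-injective : ∀ {i j} → slot i ≡ slot j → i ≡ j
    slot-injective {i} {j} eq with split (e i) | split (e j)
    ... | inj₁ p | inj₁ q = src-matchingEdge-injective {S = S} iso (cong src
      (rainbow (matchingEdge∈S {S = S} iso i) (matchingEdge∈S {S = S} iso j) (trans p (sym q))))
    ... | inj₂ p | inj₂ q = src-matchingEdge-injective {S = S} iso
      (trans (lookup-index p) (trans (cong (lookup xs) (Fin.suc-injective eq)) (sym (lookup-index q))))

  -- Lower bound: a coloring with one common color and otherwise distinct colors.

  module _ {k} (reg : IsRegular G k) where

    module _ (ps : List (Vertex G × Vertex G)) (ps! : Unique ps)
             (ps-edges : ∀ {p} → p ∈ ps → ∃[ e ] ends e ≡ p)
             (ps-short : length ps < ∣ X ∣ * k) where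

      open DecMembership _≟ᵖ_ using (_∈?_)

      private
        colorOf : ∀ {p} → Dec (p ∈ ps) → Fin (suc (length ps))
        colorOf (yes p∈) = suc (index p∈)
        colorOf (no _)   = zero

        colorOf-∉ : ∀ {p} (d : Dec (p ∈ ps)) → p ∉ ps → colorOf d ≡ zero
        colorOf-∉ (yes p∈) p∉ = contradiction p∈ p∉
        colorOf-∉ (no _)   _  = refl

        colorOf-lookup : ∀ {p} i (d : Dec (p ∈ ps)) → p ≡ lookup ps i → colorOf d ≡ suc i
        colorOf-lookup i (yes p∈) eq = cong suc (lookup-map-injective id ps
          (subst Unique (sym (map-id ps)) ps!) (index p∈) i (trans (sym (lookup-index p∈)) eq))
        colorOf-lookup i (no p∉) refl = contradiction (∈-lookup i) p∉

        colorOf-split : ∀ {p} (d : Dec (p ∈ ps)) → colorOf d ≡ zero ⊎ p ∈ ps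
        colorOf-split (yes p) = inj₂ p
        colorOf-split (no _)  = inj₁ refl

      indexColoring : EdgeColoring G (suc (length ps))
      indexColoring = record
        { color = λ e → colorOf (ends e ∈? ps)
        ; exact = λ where
            -- The common color appears because `ps` is too short to contain every edge.
            zero    → let e , e∉ = edge-avoiding reg ps ps-short in
                      e , λ { refl → colorOf-∉ (ends e ∈? ps) e∉ }
            (suc i) → let e , eq = ps-edges (∈-lookup i) in
                      e , λ { refl → colorOf-lookup i (ends e ∈? ps) eq }
        }

      indexColoring-split : ∀ e → color indexColoring e ≡ zero ⊎ ends e ∈ ps
      indexColoring-split e = colorOf-split (ends e ∈? ps)

    -- The individually colored edges lie at `q` vertices of `X`, so a rainbow matching has at most
    -- `q` of them plus one edge of the common color. Every `s` up to `q * k` is treated, since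
    -- minimality must refute each smaller number of colors.
    few-colors : ∀ q s → 0 < k → q < ∣ X ∣ → s ≤ q * k →
                 ¬ ForcesRainbow G (matching (2 + q)) (suc s)
    few-colors q s 0<k q<n s≤qk forces = refute
        (subst (ForcesRainbow G (matching (2 + q)) ∘ suc) (sym length-ps) forces coloring)
      where
      xs : List (Vertex G)
      xs = take q (elements X)
      ps : List (Vertex G × Vertex G)
      -- The `q` full stars hold `q * k` pairs; cutting to `s` of them leaves exactly `suc s`
      -- colors.
      ps = take s (outStars xs)
      length-xs : length xs ≡ q
      length-xs = trans (length-take q (elements X))
        (trans (cong (q ℕ.⊓_) (length-elements X)) (ℕ.m≤n⇒m⊓n≡m (ℕ.<⇒≤ q<n)))
      length-ps : length ps ≡ s
      length-ps = trans (length-take s (outStars xs)) (ℕ.m≤n⇒m⊓n≡m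
        (subst (s ≤_) (sym (trans (length-outStars reg xs) (cong (_* k) length-xs))) s≤qk))
      ∈-take : ∀ {A : Set} n {as : List A} {a} → a ∈ take n as → a ∈ as
      ∈-take n {as} p = subst (_ ∈_) (take++drop≡id n as) (∈-++⁺ˡ p)
      ps-ends : ∀ {p} → p ∈ ps → proj₁ p ∈ xs × Adj G (proj₁ p) (proj₂ p)
      ps-ends p∈ = ∈-outStars⁻ {xs} (∈-take s p∈)
      ps-edges : ∀ {p} → p ∈ ps → ∃[ e ] ends e ≡ p
      ps-edges p∈ = Adj⇒ends (∈-elements⁻ (∈-take q (proj₁ (ps-ends p∈)))) (proj₂ (ps-ends p∈))
      ps! : Unique ps
      ps! = Unique.take⁺ s (Unique-outStars (Unique.take⁺ q (Unique-elements X)))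
      ps-short : length ps < ∣ X ∣ * k
      ps-short = subst (_< ∣ X ∣ * k) (sym length-ps)
        (ℕ.≤-<-trans s≤qk (ℕ.*-monoˡ-< k {{>-nonZero 0<k}} q<n))
      coloring : EdgeColoring G (suc (length ps))
      coloring = indexColoring ps ps! ps-edges ps-short
      split : ∀ e → color coloring e ≡ zero ⊎ src e ∈ xs
      split e = Sum.map₂ (proj₁ ∘ ps-ends) (indexColoring-split ps ps! ps-edges ps-short e)
      refute : ¬ (∃[ S ] IsomorphicTo G (matching (2 + q)) S × Rainbow G coloring S)
      refute (S , iso , rainbow) = ℕ.<-irrefl refl (subst (2 + q ≤_) (cong suc length-xs)
        (rainbow-matching-bound coloring xs split {S = S} iso rainbow))

-- Upper bound: a rainbow matching from many colors.

module Forcing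
  (G : Graph) (X Y : Subset (order G)) (bip : IsBipartition G X Y) {k : ℕ} (reg : IsRegular G k)
  where

  open BipartiteGraph G X Y bip
  open RainbowMatchings G X Y bip

  module _ {r} {c : EdgeColoring G r} where

    open RainbowMatching

    extend : ∀ {m} (M : RainbowMatching c m) e →
             (∀ i → src e ≢ src (edgeOf M i)) → (∀ i → tgt e ≢ tgt (edgeOf M i)) →
             (∀ i → color c e ≢ color c (edgeOf M i)) → RainbowMatching c (suc m)
    extend {m} M e src≢ tgt≢ color≢ = record
      { edgeOf          = edgeOf′
      ; src-injective   = extend-injective src (src-injective M) src≢
      ; tgt-injective   = extend-injective tgt (tgt-injective M) tgt≢
      ; color-injective = extend-injective (color c) (color-injective M) color≢
      }
      where
      edgeOf′ : Fin (suc m) → Edge G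
      edgeOf′ zero    = e
      edgeOf′ (suc i) = edgeOf M i
      extend-injective : ∀ {A : Set} (f : Edge G → A) →
        (∀ i j → f (edgeOf M i) ≡ f (edgeOf M j) → i ≡ j) → (∀ i → f e ≢ f (edgeOf M i)) →
        ∀ i j → f (edgeOf′ i) ≡ f (edgeOf′ j) → i ≡ j
      extend-injective f inj f≢ zero    zero    eq = refl
      extend-injective f inj f≢ zero    (suc j) eq = contradiction eq (f≢ j)
      extend-injective f inj f≢ (suc i) zero    eq = contradiction (sym eq) (f≢ i)
      extend-injective f inj f≢ (suc i) (suc j) eq = cong suc (inj i j eq)

  module _ {r : ℕ} (c : EdgeColoring G (suc r)) where

    representative : Fin (suc r) → Edge G
    representative i = proj₁ (exact c i)

    color-representative : ∀ i → color c (representative i) ≡ i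
    color-representative i = proj₂ (exact c i) refl

    representative-injective : ∀ {i j} → representative i ≡ representative j → i ≡ j
    representative-injective {i} {j} eq =
      trans (sym (color-representative i)) (trans (cong (color c) eq) (color-representative j))

    source target : Fin (suc r) → Vertex G
    source = src ∘ representative
    target = tgt ∘ representative

    -- Colors stand for their representatives: a matching is then a list of distinct colors, so it
    -- is rainbow by construction.
    open Augmentation source target _≟ᵛ_ _≟ᵛ_
    open DecMembership (Fin._≟_ {suc r}) using (_∈?_)

    rainbow : ∀ {N m} → Matching N → length N ≡ m → RainbowMatching c m
    rainbow {N} (us , ut) refl = record
      { edgeOf          = representative ∘ lookup N
      ; src-injective   = lookup-map-injective source N us
      ; tgt-injective   = lookup-map-injective target N ut
      -- A representative has the color it stands for, so equal colors give equal sources, and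
      -- sources are distinct.
      ; color-injective = λ i j eq → lookup-map-injective source N us i j
          (cong source (trans (sym (color-representative _)) (trans eq (color-representative _))))
      }

    rainbow-extend : ∀ {N m} e → Matching N → length N ≡ m →
                     src e ∉ map source N → tgt e ∉ map target N → color c e ∉ N →
                     RainbowMatching c (suc m)
    rainbow-extend {N} e match refl s∉ t∉ c∉ = extend (rainbow match refl) e
      (λ i eq → s∉ (subst (_∈ map source N) (sym eq) (∈-map⁺ source (∈-lookup i))))
      (λ i eq → t∉ (subst (_∈ map target N) (sym eq) (∈-map⁺ target (∈-lookup i))))
      (λ i eq → c∉ (subst (_∈ N) (sym (trans eq (color-representative (lookup N i)))) (∈-lookup i)))

    cover-bound : ∀ {H w} → Unique H → Cover H w → length H ≤ w * k
    cover-bound {H} {w} H! cov = subst (λ l → length H ≤ l * k) size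
      (subst (_≤ (length WX + length WY) * k) (length-map representative H)
        (covered-length reg {map representative H} {WX} {WY}
          (Unique.map⁺ representative-injective H!) covers′))
      where
      open Cover cov
      covers′ : ∀ {e} → e ∈ map representative H → src e ∈ WX ⊎ tgt e ∈ WY
      covers′ e∈ with i , i∈ , refl ← ∈-map⁻ representative e∈ = covers i∈

    others : Fin (suc r) → List (Fin (suc r))
    others i = tabulate (punchIn i)

    ∈-others⁺ : ∀ {i j} → i ≢ j → j ∈ others i
    ∈-others⁺ {i} i≢j = subst (_∈ others i) (Fin.punchIn-punchOut i≢j) (∈-tabulate⁺ (punchOut i≢j))

    i∉others : ∀ {i} → i ∉ others i
    i∉others {i} i∈ with j , eq ← ∈-tabulate⁻ i∈ = Fin.punchInᵢ≢i i j (sym eq)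

    module _ {q : ℕ} (many : q * k < r) where

      -- At most `q` vertices cover at most `q * k` representatives, fewer than there are colors, so
      -- augmentation succeeds up to size `suc q`.
      maximum-matching : ∃[ M ] M ⊆ allFin (suc r) × Matching M × length M ≡ suc q
      maximum-matching = grow no-cover (suc q) ℕ.≤-refl
        where
        no-cover : ∀ w → w < suc q → ¬ Cover (allFin (suc r)) w
        no-cover w (s≤s w≤q) cov = ℕ.<⇒≱ many (ℕ.≤-trans (ℕ.n≤1+n r) (begin
          suc r                   ≡⟨ length-tabulate id ⟨
          length (allFin (suc r)) ≤⟨ cover-bound (Unique.allFin⁺ (suc r)) cov ⟩
          w * k                   ≤⟨ ℕ.*-monoˡ-≤ k w≤q ⟩
          q * k                   ∎))
          where open ℕ.≤-Reasoning

      -- After deletion of `i` there remain `r` colors; here `q * k < r` is needed in full strength.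
      no-cover-others : ∀ i → ¬ Cover (others i) q
      no-cover-others i cov = ℕ.<⇒≱ many (subst (_≤ q * k) (length-tabulate (punchIn i))
        (cover-bound (Unique.tabulate⁺ (λ {j} {l} → Fin.punchIn-injective i j l)) cov))

      module _ {M : List (Fin (suc r))} (M-match : Matching M) (M-size : length M ≡ suc q) where

        -- A substitute for `M` of the same size that leaves color `i` free for a further edge. `ZX`
        -- and `ZY` hold the vertices it may use besides those of `M`.
        record Detour (ZX ZY : List (Vertex G)) (i : Fin (suc r)) : Set where
          field
            N     : List (Fin (suc r))
            match : Matching N
            size  : length N ≡ suc q
            i∉N   : i ∉ N
            srcs  : map source N ⊆ ZX ++ map source M
            tgts  : map target N ⊆ ZY ++ map target M

        Detour-mono : ∀ {ZX ZX′ ZY ZY′ i} → ZX ⊆ ZX′ → ZY ⊆ ZY′ → Detour ZX ZY i → Detour ZX′ ZY′ i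
        Detour-mono ZX⊆ ZY⊆ D = record
          { Detour D hiding (srcs; tgts)
          ; srcs  = ++⁺ˡ _ ZX⊆ ∘ Detour.srcs D
          ; tgts  = ++⁺ˡ _ ZY⊆ ∘ Detour.tgts D
          }

        Detours : List (Fin (suc r)) → ℕ → Set
        Detours L w = ∃₂ λ ZX ZY → length ZX + length ZY ≡ w × (∀ {i} → i ∈ L → Detour ZX ZY i)

        -- Removing i from M and augmenting again without color i adds two
        -- vertices.  If neither is an end of i, then i can be put back;
        -- otherwise at most one of them is outside V(M).
        detour : ∀ {i} → i ∈ M → RainbowMatching c (2 + q) ⊎ Detours (i ∷ []) 1
        detour {i} i∈M with M′ , M↭ ← ∈⇒↭∷ i∈M = go M′ M↭ (Matching-resp-↭ M↭ M-match)
          where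
          go : ∀ M′ → M ↭ i ∷ M′ → Matching (i ∷ M′) →
               RainbowMatching c (2 + q) ⊎ Detours (i ∷ []) 1
          go M′ M↭ (us , ut) = Sum.[ dispatch , (λ cov → contradiction
              (subst (Cover (others i)) M′-size cov) (no-cover-others i)) ]′
              (augment M′⊆ (Unique-tail us , Unique-tail ut))
            where
            M′-size : length M′ ≡ q
            M′-size = ℕ.suc-injective (trans (sym (↭-length M↭)) M-size)
            M′⊆ : M′ ⊆ others i
            M′⊆ j∈ = ∈-others⁺ λ { refl → Unique.Unique[x∷xs]⇒x∉xs us (∈-map⁺ source j∈) }
            i∷M′⊆M : ∀ {C : Set} (f : Fin (suc r) → C) → f i ∷ map f M′ ⊆ map f M
            i∷M′⊆M f = ∈-resp-↭ (↭-sym (↭-map⁺ f M↭))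
            M′⊆M : ∀ {C : Set} (f : Fin (suc r) → C) → map f M′ ⊆ map f M
            M′⊆M f = i∷M′⊆M f ∘ there
            dispatch : Augmented (others i) M′ → RainbowMatching c (2 + q) ⊎ Detours (i ∷ []) 1
            dispatch aug with source i ≟ᵛ Augmented.newSrc aug | target i ≟ᵛ Augmented.newTgt aug
            -- The new source is an end of `i`, hence already a vertex of `M`. The new target is
            -- listed even if it is an end of `i` too, so that the count is exactly one.
            ... | yes refl | _ = inj₂ ([] , newTgt ∷ [] , refl , λ { (here refl) → record
                { N = N ; match = match ; size = trans size (cong suc M′-size)
                ; i∉N = i∉others ∘ N⊆H
                ; srcs = i∷M′⊆M source ∘ srcs
                ; tgts = ∷⁺ʳ newTgt (M′⊆M target) ∘ tgts } })
              where open Augmented aug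
            ... | no _ | yes refl = inj₂ (newSrc ∷ [] , [] , refl , λ { (here refl) → record
                { N = N ; match = match ; size = trans size (cong suc M′-size)
                ; i∉N = i∉others ∘ N⊆H
                ; srcs = ∷⁺ʳ newSrc (M′⊆M source) ∘ srcs
                ; tgts = i∷M′⊆M target ∘ tgts } })
              where open Augmented aug
            ... | no s≢ | no t≢ = inj₁ (rainbow {i ∷ N} (Matching-∷
                (λ p → Unique.Unique[x∷xs]⇒x∉xs us (∈-∷⁻ (srcs p) s≢))
                (λ p → Unique.Unique[x∷xs]⇒x∉xs ut (∈-∷⁻ (tgts p) t≢)) match)
                (cong suc (trans size (cong suc M′-size))))
              where open Augmented aug

        -- Each color of `L` adds one extra vertex, and a detour survives when the lists of allowed
        -- vertices grow.
        detours : ∀ L → L ⊆ M → RainbowMatching c (2 + q) ⊎ Detours L (length L)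
        detours []      _   = inj₂ ([] , [] , refl , λ ())
        detours (i ∷ L) L⊆M with detour (L⊆M (here refl)) | detours L (L⊆M ∘ there)
        ... | inj₁ R | _      = inj₁ R
        ... | inj₂ _ | inj₁ R = inj₁ R
        ... | inj₂ (ZX , ZY , size , D) | inj₂ (ZX′ , ZY′ , size′ , D′) =
          inj₂ (ZX ++ ZX′ , ZY ++ ZY′ , size″ , λ where
            (here refl) → Detour-mono ∈-++⁺ˡ ∈-++⁺ˡ (D (here refl))
            (there i∈)  → Detour-mono (∈-++⁺ʳ ZX) (∈-++⁺ʳ ZY) (D′ i∈))
          where
          open ≡-Reasoning
          size″ : length (ZX ++ ZX′) + length (ZY ++ ZY′) ≡ suc (length L)
          size″ = begin
            length (ZX ++ ZX′) + length (ZY ++ ZY′)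
              ≡⟨ cong₂ _+_ (length-++ ZX) (length-++ ZY) ⟩
            (length ZX + length ZX′) + (length ZY + length ZY′)
              ≡⟨ interchange (length ZX) (length ZX′) (length ZY) (length ZY′) ⟩
            (length ZX + length ZY) + (length ZX′ + length ZY′)
              ≡⟨ cong₂ _+_ size size′ ⟩
            suc (length L) ∎

        rainbow-from-detours : 0 < k → 3 * suc q < ∣ X ∣ → Detours M (length M) →
                               RainbowMatching c (2 + q)
        rainbow-from-detours 0<k large (ZX , ZY , Z-size , D) =
            -- The edge avoids the two ends of each edge of `M` and one extra vertex per color of
            -- `M`, three times `suc q` vertices in all.
            complete (uncovered-edge reg 0<k (ZX ++ map source M) (ZY ++ map target M)
              (subst (_< ∣ X ∣) (sym W-size) large))
          where
          open ≡-Reasoning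
          t = length M
          W-size : length (ZX ++ map source M) + length (ZY ++ map target M) ≡ 3 * suc q
          W-size = begin
            length (ZX ++ map source M) + length (ZY ++ map target M)
              ≡⟨ cong₂ _+_
                   (trans (length-++ ZX) (cong (length ZX +_) (length-map source M)))
                   (trans (length-++ ZY) (cong (length ZY +_) (length-map target M))) ⟩
            (length ZX + t) + (length ZY + t)
              ≡⟨ interchange (length ZX) t (length ZY) t ⟩
            (length ZX + length ZY) + (t + t)
              ≡⟨ cong₂ _+_ Z-size (cong (t +_) (sym (ℕ.+-identityʳ t))) ⟩
            3 * t
              ≡⟨ cong (3 *_) M-size ⟩
            3 * suc q ∎
          complete : ∃[ e ] src e ∉ ZX ++ map source M × tgt e ∉ ZY ++ map target M →
                     RainbowMatching c (2 + q)
          -- If `M` lacks the color of `e`, then `e` extends `M`; otherwise it extends the detour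
          -- that omits this color.
          complete (e , s∉ , t∉) with color c e ∈? M
          ... | no c∉M  = rainbow-extend e M-match M-size (s∉ ∘ ∈-++⁺ʳ ZX) (t∉ ∘ ∈-++⁺ʳ ZY) c∉M
          ... | yes c∈M = rainbow-extend e match size (s∉ ∘ srcs) (t∉ ∘ tgts) i∉N
            where open Detour (D c∈M)

      rainbow-matching : 0 < k → 3 * suc q < ∣ X ∣ → RainbowMatching c (2 + q)
      rainbow-matching 0<k large with M , _ , match , size ← maximum-matching =
        Sum.[ id , rainbow-from-detours match size 0<k large ]′ (detours match size M id)

  many-colors : ∀ {q r} → q * k < r → 0 < k → 3 * suc q < ∣ X ∣ →
                ForcesRainbow G (matching (2 + q)) (suc r)
  many-colors many 0<k large c =
      matchingSubgraph R , matchingSubgraph-iso R , matchingSubgraph-rainbow R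
    where
    R = rainbow-matching c many 0<k large

-- The two bounds combined, with `q` equal to `m` minus 2.

theorem2p5 : (m k n : ℕ) → m ≥ 2 → k ≥ 3 → k ≤ n → n > 3 * (m ∸ 1) →
    (B : Graph) (X Y : Subset (order B)) →
    IsBipartition B X Y → IsRegular B k → ∣ X ∣ ≡ n → ∣ Y ∣ ≡ n →
    IsRainbowNumber B (matching m) (k * (m ∸ 2) + 2)
theorem2p5 (suc zero) _ _ (s≤s ())
theorem2p5 (suc (suc q)) k _ _ k≥3 _ large B X Y bip reg refl _ = record
  { positive = ℕ.≤-trans (s≤s z≤n) (ℕ.m≤n+m 2 (k * q))
  ; forces   = subst (ForcesRainbow B (matching (2 + q))) (sym colors)
                 -- Here `r` is `suc (q * k)`, the least value above `q * k`, so the number of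
                 -- colors is `2 + q * k`.
                 (many-colors (ℕ.n<1+n (q * k)) 0<k large)
  ; minimal  = minimal
  }
  where
  open RainbowMatchings B X Y bip using (few-colors)
  open Forcing B X Y bip reg using (many-colors)
  0<k : 0 < k
  0<k = ℕ.≤-trans (s≤s z≤n) k≥3
  q<n : q < ∣ X ∣
  q<n = ℕ.≤-<-trans (ℕ.≤-trans (ℕ.n≤1+n q) (ℕ.m≤m+n (suc q) _)) large
  colors : k * q + 2 ≡ 2 + q * k
  colors = trans (ℕ.+-comm (k * q) 2) (cong (2 +_) (ℕ.*-comm k q))
  minimal : ∀ s → 1 ≤ s → ForcesRainbow B (matching (2 + q)) s → k * q + 2 ≤ s
  -- With `suc s` colors, one is the common color; fewer than `k * q + 2` colors in total means
  -- `s ≤ q * k`.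
  minimal (suc s) _ forces = ℕ.≮⇒≥ λ s<r →
    few-colors reg q s 0<k q<n (s≤s⁻¹ (s≤s⁻¹ (subst (2 + s ≤_) colors s<r))) forces
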